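{- Let $r\ge1$ and let $p_1,p_2,\ldots,p_r$ be primes, each $\ge5$ (not necessarily distinct). Then for every $n\ge0$, \[ b_2\!\left(\prod_{s=1}^{r-1}p_s^2\,p_{r}\, n+\frac{(24j+1)\prod_{s=1}^{r-1}p_s^2-1}{24}\right)\equiv 0 \pmod 2 \] for every integer $j$ with $0\le j\le p_r-1$ and $\left(\frac{24j+1}{p_r}\right)=-1$ (with the empty product equal to $1$).
   Context: For a positive integer $\ell$, $b_\ell(n)$ denotes the number of partitions of $n$ having no part divisible by $\ell$. $\left(\frac{a}{p}\right)$ is the Legendre symbol. -}

module Defs where

open import Data.Fin.Base using (Fin; toℕ)
open import Data.Fin.Properties using (any?)
open import Data.Integer.Base as ℤ using (ℤ; 0ℤ; 1ℤ; -1ℤ)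
import Data.Integer.Divisibility.Signed as ℤ
open import Data.List.Base
  using (List; []; _∷_; _++_; map; concatMap; filter; length; replicate; upTo)
open import Data.List.Membership.Propositional using (_∈_; find; lose)
open import Data.List.Membership.Propositional.Properties
  using (∈-concatMap⁺; ∈-concatMap⁻; ∈-map⁺; ∈-map⁻; ∈-upTo⁺; ∈-upTo⁻)
open import Data.List.Properties using (++-cancelˡ)
open import Data.List.Relation.Binary.Disjoint.Propositional using (Disjoint)
open import Data.List.Relation.Unary.All as All using (All; []; _∷_; all?)
import Data.List.Relation.Unary.All.Properties as All
open import Data.List.Relation.Unary.AllPairs as AllPairs using (AllPairs; []; _∷_)
import Data.List.Relation.Unary.AllPairs.Properties as AllPairs
open import Data.List.Relation.Unary.Any using (here)
open import Data.List.Relation.Unary.Unique.Propositional using (Unique)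
import Data.List.Relation.Unary.Unique.Propositional.Properties as Unique
open import Data.Nat.Base
open import Data.Nat.Divisibility using (_∣_; _∣?_)
open import Data.Nat.DivMod using (_/_; m*n/n≡m; m/n*n≤m; /-monoˡ-≤)
open import Data.Nat.ListAction using (sum)
open import Data.Nat.ListAction.Properties using (sum-++)
open import Data.Nat.Properties
open import Data.Product.Base using (∃; _×_; _,_; proj₁; proj₂)
open import Data.Vec.Functional using (Vector; foldr)
open import Function.Bundles using (_⇔_; mk⇔)
open import Relation.Binary.PropositionalEquality
  using (_≡_; _≢_; refl; sym; trans; cong; subst)
open import Relation.Nullary.Decidable using (Dec; yes; no; ¬?)
open import Relation.Nullary.Negation using (¬_; contradiction)

------------------------------------------------------------------------
-- Partitions

record IsPartition (n : ℕ) (parts : List ℕ) : Set where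
  constructor isPartition
  field
    positive   : All (1 ≤_) parts
    decreasing : AllPairs _≥_ parts
    sum≡       : sum parts ≡ n

open IsPartition public

-- Partitions of n with all parts ≤ k; in the second clause m is the
-- multiplicity of the part k.
partitions≤ : (k n : ℕ) → List (List ℕ)
partitions≤ zero    zero    = [] ∷ []
partitions≤ zero    (suc n) = []
partitions≤ k@(suc k-1) n   =
  concatMap (λ m → map (replicate m k ++_) (partitions≤ k-1 (n ∸ m * k)))
            (upTo (suc (n / k)))

-- By ∈-partitions and partitions-unique below, this lists every partition
-- of n exactly once.
partitions : ℕ → List (List ℕ)
partitions n = partitions≤ n n

Regular : (ℓ : ℕ) → List ℕ → Set
Regular ℓ = All (λ part → ¬ (ℓ ∣ part))

regular? : ∀ ℓ parts → Dec (Regular ℓ parts)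
regular? ℓ = all? (λ part → ¬? (ℓ ∣? part))

b : (ℓ n : ℕ) → ℕ
b ℓ n = length (filter (regular? ℓ) (partitions n))

------------------------------------------------------------------------
-- Legendre symbol

-- It suffices to look for a square root among the residues 0, …, p - 1.
SquareMod : ℕ → ℤ → Set
SquareMod p a = ∃ λ (x : Fin p) → ℤ.+ p ℤ.∣ ℤ.+ toℕ x ℤ.* ℤ.+ toℕ x ℤ.- a

squareMod? : ∀ p a → Dec (SquareMod p a)
squareMod? p a = any? λ x → ℤ.+ p ℤ.∣? ℤ.+ toℕ x ℤ.* ℤ.+ toℕ x ℤ.- a

legendre : (a : ℤ) (p : ℕ) → ℤ
legendre a p with ℤ.+ p ℤ.∣? a | squareMod? p a
... | yes _ | _     = 0ℤ
... | no  _ | yes _ = 1ℤ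
... | no  _ | no  _ = -1ℤ

------------------------------------------------------------------------
-- Products of squares

∏² : ∀ {m} → Vector ℕ m → ℕ
∏² = foldr (λ p acc → p ^ 2 * acc) 1

------------------------------------------------------------------------
-- Correctness of the enumeration of partitions

private
  sum-replicate : ∀ m x → sum (replicate m x) ≡ m * x
  sum-replicate zero    x = refl
  sum-replicate (suc m) x = cong (x +_) (sum-replicate m x)

  sum-replicate-++ : ∀ m x ys → sum (replicate m x ++ ys) ≡ m * x + sum ys
  sum-replicate-++ m x ys =
    trans (sum-++ (replicate m x) ys) (cong (_+ sum ys) (sum-replicate m x))

  replicate-decreasing : ∀ m {k ys} → All (_≤ k) ys → AllPairs _≥_ ys →
                         AllPairs _≥_ (replicate m k ++ ys)
  replicate-decreasing zero    ys≤k dec = dec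
  replicate-decreasing (suc m) ys≤k dec =
    All.++⁺ (All.replicate⁺ m ≤-refl) ys≤k ∷ replicate-decreasing m ys≤k dec

  decreasing-suffix : ∀ xs {ys} → AllPairs _≥_ (xs ++ ys) → AllPairs _≥_ ys
  decreasing-suffix []       dec       = dec
  decreasing-suffix (x ∷ xs) (_ ∷ dec) = decreasing-suffix xs dec

  split : ∀ k xs → All (_≤ suc k) xs → AllPairs _≥_ xs →
          ∃ λ m → ∃ λ ys → xs ≡ replicate m (suc k) ++ ys × All (_≤ k) ys
  split k []       _             _          = 0 , [] , refl , []
  split k (x ∷ xs) (x≤ ∷ xs≤) (x≥xs ∷ dec) with x ≟ suc k
  ... | no x≢  = 0 , x ∷ xs , refl , x≤k ∷ All.map (λ x≥y → ≤-trans x≥y x≤k) x≥xs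
    where x≤k = s≤s⁻¹ (≤∧≢⇒< x≤ x≢)
  ... | yes refl with split k xs xs≤ dec
  ...   | m , ys , refl , ys≤ = suc m , ys , refl , ys≤

  sound : ∀ k n {xs} → xs ∈ partitions≤ k n → All (_≤ k) xs × IsPartition n xs
  sound zero zero (here refl) = [] , isPartition [] [] refl
  sound (suc k) n xs∈ with find (∈-concatMap⁻ _ {xs = upTo (suc (n / suc k))} xs∈)
  ... | m , m∈ , xs∈map with ∈-map⁻ (replicate m (suc k) ++_) xs∈map
  ...   | ys , ys∈ , refl with sound k (n ∸ m * suc k) ys∈
  ...     | ys≤k , isPartition pos dec sum≡ =
    All.++⁺ (All.replicate⁺ m ≤-refl) ys≤ ,
    isPartition (All.++⁺ (All.replicate⁺ m (s≤s z≤n)) pos)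
                (replicate-decreasing m ys≤ dec)
                (trans (sum-replicate-++ m (suc k) ys)
                  (trans (cong (_ +_) sum≡) (m+[n∸m]≡n mk≤n)))
    where
    ys≤ = All.map m≤n⇒m≤1+n ys≤k
    mk≤n : m * suc k ≤ n
    mk≤n = ≤-trans (*-monoˡ-≤ (suc k) (s≤s⁻¹ (∈-upTo⁻ m∈))) (m/n*n≤m n (suc k))

  complete : ∀ k n {xs} → All (_≤ k) xs → IsPartition n xs → xs ∈ partitions≤ k n
  complete zero n {[]}     _          (isPartition _ _ refl)      = here refl
  complete zero n {x ∷ xs} (x≤0 ∷ _)  (isPartition (1≤x ∷ _) _ _) =
    contradiction (≤-trans 1≤x x≤0) λ ()
  complete (suc k) n {xs} xs≤ (isPartition pos dec sum≡) with split k xs xs≤ dec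
  ... | m , ys , refl , ys≤k =
    ∈-concatMap⁺ _ (lose (∈-upTo⁺ (s≤s m≤)) (∈-map⁺ _ (complete k _ ys≤k
      (isPartition (All.++⁻ʳ (replicate m (suc k)) pos)
                   (decreasing-suffix (replicate m (suc k)) dec)
                   (sym (trans (cong (_∸ m * suc k) n≡) (m+n∸m≡n (m * suc k) _)))))))
    where
    n≡ : n ≡ m * suc k + sum ys
    n≡ = trans (sym sum≡) (sum-replicate-++ m (suc k) ys)
    m≤ : m ≤ n / suc k
    m≤ = subst (_≤ n / suc k) (m*n/n≡m m (suc k))
           (/-monoˡ-≤ (suc k) (subst (m * suc k ≤_) (sym n≡) (m≤m+n _ _)))

  parts≤sum : ∀ xs → All (_≤ sum xs) xs
  parts≤sum []       = []
  parts≤sum (x ∷ xs) =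
    m≤m+n x _ ∷ All.map (λ y≤ → ≤-trans y≤ (m≤n+m _ x)) (parts≤sum xs)

  multiplicity-unique : ∀ {k} m m′ {ys ys′} → All (_≤ k) ys → All (_≤ k) ys′ →
    replicate m (suc k) ++ ys ≡ replicate m′ (suc k) ++ ys′ → m ≡ m′
  multiplicity-unique zero    zero     _        _         _    = refl
  multiplicity-unique zero    (suc m′) (k< ∷ _) _         refl = contradiction k< 1+n≰n
  multiplicity-unique (suc m) zero     _        (k< ∷ _)  refl = contradiction k< 1+n≰n
  multiplicity-unique (suc m) (suc m′) ys≤      ys′≤      eq   =
    cong suc (multiplicity-unique m m′ ys≤ ys′≤ (++-cancelˡ (suc _ ∷ []) _ _ eq))

  unique : ∀ k n → Unique (partitions≤ k n)
  unique zero    zero    = [] ∷ []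
  unique zero    (suc n) = []
  unique (suc k) n       = Unique.concat⁺
    (All.map⁺ (All.universal
      (λ m → Unique.map⁺ (++-cancelˡ (replicate m (suc k)) _ _) (unique k _)) _))
    (AllPairs.map⁺ (AllPairs.map disjoint (Unique.upTo⁺ (suc (n / suc k)))))
    where
    disjoint : ∀ {m m′} → m ≢ m′ →
      Disjoint (map (replicate m (suc k) ++_) (partitions≤ k (n ∸ m * suc k)))
               (map (replicate m′ (suc k) ++_) (partitions≤ k (n ∸ m′ * suc k)))
    disjoint {m} {m′} m≢m′ (p , q) with ∈-map⁻ _ p | ∈-map⁻ _ q
    ... | _ , ys∈ , refl | _ , ys′∈ , eq = m≢m′
      (multiplicity-unique m m′ (proj₁ (sound k _ ys∈)) (proj₁ (sound k _ ys′∈)) eq)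

∈-partitions : ∀ n parts → parts ∈ partitions n ⇔ IsPartition n parts
∈-partitions n parts = mk⇔
  (λ parts∈ → proj₂ (sound n n parts∈))
  (λ isP → complete n n
    (subst (λ s → All (_≤ s) parts) (sum≡ isP) (parts≤sum parts)) isP)

partitions-unique : ∀ n → Unique (partitions n)
partitions-unique n = unique n n

{-# OPTIONS --safe #-}
module Submission where

-- Over 𝔽₂ the generating function of the 2-regular partitions is
--   ∏ 1/(1 - q^(2k-1)) = ∏ (1 + q^(2k)) / ∏ (1 + q^k) = ∏ (1 + q^k),
-- which by the pentagonal number theorem is supported on the N for which
-- 24N + 1 is a square.  For the N of the theorem, 24N + 1 is the product of
-- p₁² ⋯ pᵣ₋₁² and a number congruent to 24j + 1 modulo pᵣ; were it a square,
-- dividing out the pᵢ² would make 24j + 1 a square modulo pᵣ.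

open import Defs
open import Data.Fin.Base using (Fin; zero; suc; fromℕ; fromℕ<; inject₁; toℕ)
open import Data.Fin.Properties using (toℕ-fromℕ<)
import Data.Fin.Properties as Fin
open import Data.Integer.Base as ℤ using (+_; -1ℤ)
import Data.Integer.Divisibility.Signed as ℤ
import Data.Integer.Properties as ℤ
import Data.Integer.Tactic.RingSolver as ℤ-Solver
open import Data.List.Base
  using (List; []; _∷_; _++_; map; concatMap; filter; length; replicate; applyUpTo; upTo)
open import Data.List.Properties
  using (filter-++; filter-none; length-++; map-cong; map-upTo; map-∘)
open import Data.List.Relation.Unary.All as All using ([]; _∷_)
import Data.List.Relation.Unary.All.Properties as All
open import Data.Nat.Base
  using (ℕ; zero; suc; parity; _+_; _*_; _∸_; _^_; _≤_; _<_; z<s; s≤s; NonZero)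
open import Data.Nat.Divisibility
  using (_∣_; _∣?_; divides; ∣1⇒≡1; ∣m+n∣m⇒∣n; ∣n∣m%n⇒∣m)
open import Data.Nat.DivMod
  using (_/_; _%_; _mod_; m≡m%n+[m/n]*n; m%n<n; m*n/n≡m; m<n⇒m/n≡0; m/n≡1+[m∸n]/n;
         %-distribˡ-*; [m+n]%n≡m%n; [m+kn]%n≡m%n)
open import Data.Nat.ListAction using (sum)
open import Data.Nat.Primality using (Prime; prime⇒nonZero; euclidsLemma; prime⇒irreducible)
open import Data.Nat.Properties
open import Data.Nat.Tactic.RingSolver using (solve-∀)
open import Data.Parity.Base as ℙ using (Parity; 0ℙ; 1ℙ)
import Data.Parity.Properties as ℙ
open import Data.Product.Base using (∃; _,_)
open import Data.Sum.Base using (_⊎_; inj₁; inj₂; [_,_]′)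
open import Data.Vec.Functional using (Vector; init; last; tail)
open import Function.Base using (_∘_; id)
open import Level using (Level)
open import Relation.Binary.PropositionalEquality
  using (_≡_; _≢_; _≗_; refl; sym; trans; cong; cong₂; subst; module ≡-Reasoning)
open import Relation.Nullary.Decidable using (yes; no; toWitness; _⊎-dec_)
open import Relation.Nullary.Negation using (¬_; contradiction)
open import Relation.Unary using (Pred; Decidable)

open import Algebra.Properties.CommutativeSemigroup ℙ.+-commutativeSemigroup
  using (interchange)

private variable
  a p′ : Level
  A B : Set a
  f g : ℕ → Parity

-- Power series over 𝔽₂, as coefficient sequences

infixl 6 _⊕_

_⊕_ : (f g : ℕ → Parity) → ℕ → Parity
(f ⊕ g) n = f n ℙ.+ g n

δ : ℕ → Parity
δ zero    = 1ℙ
δ (suc _) = 0ℙ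

-- Multiplication by `q^k`, with `δ` as the series 1.
shift : ℕ → (ℕ → Parity) → ℕ → Parity
shift zero    f n       = f n
shift (suc k) f zero    = 0ℙ
shift (suc k) f (suc n) = shift k f n

1+q^ : ℕ → (ℕ → Parity) → ℕ → Parity
1+q^ k f = f ⊕ shift k f

-- ∏ s d f is (1 + q^(s+1)) ⋯ (1 + q^(s+d)) f.
∏ : (s d : ℕ) → (ℕ → Parity) → ℕ → Parity
∏ s zero    f = f
∏ s (suc d) f = 1+q^ (s + suc d) (∏ s d f)

p+[p+q]≡q : ∀ p q → p ℙ.+ (p ℙ.+ q) ≡ q
p+[p+q]≡q p q = trans (sym (ℙ.+-assoc p p q)) (cong (ℙ._+ q) (ℙ.p+p≡0ℙ p))

[p+q]+[q+r]≡p+r : ∀ p q r → (p ℙ.+ q) ℙ.+ (q ℙ.+ r) ≡ p ℙ.+ r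
[p+q]+[q+r]≡p+r p q r = trans (ℙ.+-assoc p q _) (cong (p ℙ.+_) (p+[p+q]≡q q r))

shift-cong : ∀ k → f ≗ g → shift k f ≗ shift k g
shift-cong zero    f≗g n       = f≗g n
shift-cong (suc k) f≗g zero    = refl
shift-cong (suc k) f≗g (suc n) = shift-cong k f≗g n

shift-⊕ : ∀ k f g → shift k (f ⊕ g) ≗ shift k f ⊕ shift k g
shift-⊕ zero    f g n       = refl
shift-⊕ (suc k) f g zero    = refl
shift-⊕ (suc k) f g (suc n) = shift-⊕ k f g n

shift-shift : ∀ k l f → shift k (shift l f) ≗ shift (k + l) f
shift-shift zero    l f n       = refl
shift-shift (suc k) l f zero    = refl
shift-shift (suc k) l f (suc n) = shift-shift k l f n

shift-< : ∀ {k n} f → n < k → shift k f n ≡ 0ℙ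
shift-< {suc k} {zero}  f _         = refl
shift-< {suc k} {suc n} f (s≤s n<k) = shift-< f n<k

shift-+ : ∀ k f n → shift k f (k + n) ≡ f n
shift-+ zero    f n = refl
shift-+ (suc k) f n = shift-+ k f n

shift-δ : ∀ k n → n ≢ k → shift k δ n ≡ 0ℙ
shift-δ zero    zero    n≢k = contradiction refl n≢k
shift-δ zero    (suc n) n≢k = refl
shift-δ (suc k) zero    n≢k = refl
shift-δ (suc k) (suc n) n≢k = shift-δ k n (n≢k ∘ cong suc)

shift-comm : ∀ k l f → shift k (shift l f) ≗ shift l (shift k f)
shift-comm k l f n = begin
  shift k (shift l f) n ≡⟨ shift-shift k l f n ⟩
  shift (k + l) f n     ≡⟨ cong (λ m → shift m f n) (+-comm k l) ⟩
  shift (l + k) f n     ≡⟨ shift-shift l k f n ⟨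
  shift l (shift k f) n ∎
  where open ≡-Reasoning

1+q^-cong : ∀ k → f ≗ g → 1+q^ k f ≗ 1+q^ k g
1+q^-cong k f≗g n = cong₂ ℙ._+_ (f≗g n) (shift-cong k f≗g n)

shift-1+q^ : ∀ k l f → shift k (1+q^ l f) ≗ 1+q^ l (shift k f)
shift-1+q^ k l f n =
  trans (shift-⊕ k f (shift l f) n) (cong (shift k f n ℙ.+_) (shift-comm k l f n))

1+q^-comm : ∀ k l f → 1+q^ k (1+q^ l f) ≗ 1+q^ l (1+q^ k f)
1+q^-comm k l f n = begin
  1+q^ l f n ℙ.+ shift k (1+q^ l f) n                               ≡⟨ cong (1+q^ l f n ℙ.+_) (shift-1+q^ k l f n) ⟩
  (f n ℙ.+ shift l f n) ℙ.+ (shift k f n ℙ.+ shift l (shift k f) n) ≡⟨ interchange (f n) _ _ _ ⟩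
  1+q^ k f n ℙ.+ (shift l f n ℙ.+ shift l (shift k f) n)            ≡⟨ cong (1+q^ k f n ℙ.+_) (shift-⊕ l f (shift k f) n) ⟨
  1+q^ l (1+q^ k f) n                                               ∎
  where open ≡-Reasoning

-- Frobenius: the two cross terms `shift k f` cancel in characteristic 2.
1+q^-square : ∀ k f → 1+q^ k (1+q^ k f) ≗ 1+q^ (k + k) f
1+q^-square k f n = begin
  1+q^ k f n ℙ.+ shift k (1+q^ k f) n                               ≡⟨ cong (1+q^ k f n ℙ.+_) (shift-⊕ k f (shift k f) n) ⟩
  (f n ℙ.+ shift k f n) ℙ.+ (shift k f n ℙ.+ shift k (shift k f) n) ≡⟨ [p+q]+[q+r]≡p+r (f n) _ _ ⟩
  f n ℙ.+ shift k (shift k f) n                                     ≡⟨ cong (f n ℙ.+_) (shift-shift k k f n) ⟩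
  1+q^ (k + k) f n                                                  ∎
  where open ≡-Reasoning

shift-cong-≤ : ∀ k n → (∀ {m} → m ≤ n → f m ≡ g m) → shift k f n ≡ shift k g n
shift-cong-≤ zero    n       f≡g = f≡g ≤-refl
shift-cong-≤ (suc k) zero    f≡g = refl
shift-cong-≤ (suc k) (suc n) f≡g = shift-cong-≤ k n (f≡g ∘ m≤n⇒m≤1+n)

-- A factor with constant term 1 cancels, since each coefficient is determined by the lower ones.
-- The exponent is kept positive because `1 + q^0` is zero over 𝔽₂.
1+q^-injective : ∀ k → 1+q^ (suc k) f ≗ 1+q^ (suc k) g → f ≗ g
1+q^-injective {f} {g} k eq n = below n ≤-refl
  where
  -- Strong induction through the bound `n`, as the shift may reach back to any lower coefficient.
  below : ∀ n {m} → m ≤ n → f m ≡ g m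
  below n {zero} _ = ℙ.+-cancelʳ-≡ 0ℙ _ _ (eq zero)
  below (suc n) {suc m} (s≤s m≤n) = ℙ.+-cancelʳ-≡ (shift k f m) _ _ (begin
    f (suc m) ℙ.+ shift k f m ≡⟨ eq (suc m) ⟩
    g (suc m) ℙ.+ shift k g m ≡⟨ cong (g (suc m) ℙ.+_)
                                   (shift-cong-≤ k m λ i≤m → below n (≤-trans i≤m m≤n)) ⟨
    g (suc m) ℙ.+ shift k f m ∎)
    where open ≡-Reasoning

∏-cong : ∀ s d → f ≗ g → ∏ s d f ≗ ∏ s d g
∏-cong s zero    f≗g = f≗g
∏-cong s (suc d) f≗g = 1+q^-cong (s + suc d) (∏-cong s d f≗g)

∏-1+q^ : ∀ s d k f → ∏ s d (1+q^ k f) ≗ 1+q^ k (∏ s d f)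
∏-1+q^ s zero    k f n = refl
∏-1+q^ s (suc d) k f n =
  trans (1+q^-cong (s + suc d) (∏-1+q^ s d k f) n) (1+q^-comm (s + suc d) k (∏ s d f) n)

-- `∏` recurses on its highest factor; the lowest one has to be commuted past all the others.
∏-first : ∀ s d f → 1+q^ (suc s) (∏ (suc s) d f) ≗ ∏ s (suc d) f
∏-first s zero    f n = cong (λ k → 1+q^ k f n) (sym (+-comm s 1))
∏-first s (suc d) f n = begin
  1+q^ (suc s) (1+q^ (suc s + suc d) (∏ (suc s) d f)) n ≡⟨ 1+q^-comm (suc s) (suc s + suc d) (∏ (suc s) d f) n ⟩
  1+q^ (suc s + suc d) (1+q^ (suc s) (∏ (suc s) d f)) n ≡⟨ 1+q^-cong (suc s + suc d) (∏-first s d f) n ⟩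
  1+q^ (suc s + suc d) (∏ s (suc d) f) n                ≡⟨ cong (λ k → 1+q^ k (∏ s (suc d) f) n) (+-suc s (suc d)) ⟨
  ∏ s (suc (suc d)) f n                                 ∎
  where open ≡-Reasoning

1+q^-< : ∀ {k n} f → n < k → 1+q^ k f n ≡ f n
1+q^-< {n = n} f n<k = trans (cong (f n ℙ.+_) (shift-< f n<k)) (ℙ.+-identityʳ (f n))

-- All exponents in the product exceed `s`, hence `n`, so no factor reaches the coefficient `n`.
∏-≤ : ∀ {s n} d f → n ≤ s → ∏ s d f n ≡ f n
∏-≤ zero    f n≤s = refl
∏-≤ {s} (suc d) f n≤s =
  trans (1+q^-< (∏ s d f) (≤-<-trans n≤s (m<m+n s z<s))) (∏-≤ d f n≤s)

-- Shanks' finite form of the pentagonal number theorem: the partial sums of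
--   Σ_{s ≤ n} (1 + q^(s+1)) ⋯ (1 + q^n) q^(sn + s(s+1)/2)
-- telescope in n.  All terms but s = 0 have degree above n, and increasing n
-- adds exactly two pentagonal powers of q.

triangle : ℕ → ℕ
triangle zero    = zero
triangle (suc n) = suc n + triangle n

triangle*2 : ∀ n → 2 * triangle n ≡ n * suc n
triangle*2 zero    = refl
triangle*2 (suc n) = begin
  2 * (suc n + triangle n)     ≡⟨ *-distribˡ-+ 2 (suc n) (triangle n) ⟩
  2 * suc n + 2 * triangle n   ≡⟨ cong (_+_ (2 * suc n)) (triangle*2 n) ⟩
  2 * suc n + n * suc n        ≡⟨ lemma n ⟩
  suc n * suc (suc n)          ∎
  where
  open ≡-Reasoning
  lemma : ∀ n → 2 * suc n + n * suc n ≡ suc n * suc (suc n)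
  lemma = solve-∀

-- The summand s for n = s + d.
term : (s d : ℕ) → ℕ → Parity
term s d = shift (s * (s + d) + triangle s) (∏ s d δ)

-- The sum of the summands 0, …, s, again for n = s + d.
partialSum : (s d : ℕ) → ℕ → Parity
partialSum zero    d = term zero d
partialSum (suc s) d = partialSum s (suc d) ⊕ term (suc s) d

-- With n = s + d, this is what the power `q^(n+1)` in the last factor `1 + q^(n+1)` contributes to
-- the summand `s` for n + 1. By `partialSum-suc` it is also the whole change of the partial sum.
-- For d = 0 it is a single power of `q`.
boundary : (s d : ℕ) → ℕ → Parity
boundary s d = shift (suc s * (s + suc d) + triangle s) (∏ s d δ)

term-suc : ∀ s d → term s (suc d) ≗ shift s (term s d) ⊕ boundary s d
term-suc s d n = begin
  term s (suc d) n
    ≡⟨ shift-⊕ e (∏ s d δ) (shift (s + suc d) (∏ s d δ)) n ⟩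
  shift e (∏ s d δ) n ℙ.+ shift e (shift (s + suc d) (∏ s d δ)) n
    ≡⟨ cong₂ ℙ._+_ first second ⟩
  shift s (term s d) n ℙ.+ boundary s d n ∎
  where
  open ≡-Reasoning
  e = s * (s + suc d) + triangle s
  first-exponent : ∀ s d t → s * (s + suc d) + t ≡ s + (s * (s + d) + t)
  first-exponent = solve-∀
  second-exponent : ∀ s d t → s * (s + suc d) + t + (s + suc d) ≡ suc s * (s + suc d) + t
  second-exponent = solve-∀
  first = trans (cong (λ k → shift k (∏ s d δ) n) (first-exponent s d (triangle s)))
                (sym (shift-shift s _ (∏ s d δ) n))
  second = trans (shift-shift e (s + suc d) (∏ s d δ) n)
                 (cong (λ k → shift k (∏ s d δ) n) (second-exponent s d (triangle s)))

-- `1 + q^(s+1)` is the factor that `∏ (suc s) d` lacks, and the exponents match because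
-- `triangle (suc s)` supplies one more `suc s`. This coincidence is what makes the sums telescope.
1+q^-term : ∀ s d → 1+q^ (suc s) (term (suc s) d) ≗ boundary s (suc d)
1+q^-term s d n = begin
  1+q^ (suc s) (term (suc s) d) n
    ≡⟨ shift-1+q^ e (suc s) (∏ (suc s) d δ) n ⟨
  shift e (1+q^ (suc s) (∏ (suc s) d δ)) n
    ≡⟨ shift-cong e (∏-first s d δ) n ⟩
  shift e (∏ s (suc d) δ) n
    ≡⟨ cong (λ k → shift k (∏ s (suc d) δ) n) (exponent s d (triangle s)) ⟩
  boundary s (suc d) n ∎
  where
  open ≡-Reasoning
  e = suc s * (suc s + d) + triangle (suc s)
  exponent : ∀ s d t → suc s * (suc s + d) + (suc s + t) ≡ suc s * (s + suc (suc d)) + t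
  exponent = solve-∀

-- Induction on `s`. By `term-suc` the two new summands add up to `1 + q^(s+1)` times
-- `term (suc s) d`, plus `boundary (suc s) d`; by `1+q^-term` the former is `boundary s (suc d)`,
-- which cancels the induction hypothesis. For s = 0 the shift in `term-suc` is trivial and the
-- summands themselves cancel.
partialSum-suc : ∀ s d → partialSum s d ⊕ partialSum s (suc d) ≗ boundary s d
partialSum-suc zero d n =
  trans (cong (term zero d n ℙ.+_) (term-suc zero d n)) (p+[p+q]≡q (term zero d n) _)
partialSum-suc (suc s) d n = begin
  (S ℙ.+ T) ℙ.+ (S′ ℙ.+ term (suc s) (suc d) n)
    ≡⟨ interchange S T S′ _ ⟩
  (S ℙ.+ S′) ℙ.+ (T ℙ.+ term (suc s) (suc d) n)
    ≡⟨ cong₂ ℙ._+_ (partialSum-suc s (suc d) n) (cong (T ℙ.+_) (term-suc (suc s) d n)) ⟩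
  boundary s (suc d) n ℙ.+ (T ℙ.+ (shift (suc s) (term (suc s) d) n ℙ.+ boundary (suc s) d n))
    ≡⟨ cong (boundary s (suc d) n ℙ.+_) (ℙ.+-assoc T _ _) ⟨
  boundary s (suc d) n ℙ.+ (1+q^ (suc s) (term (suc s) d) n ℙ.+ boundary (suc s) d n)
    ≡⟨ cong (λ x → boundary s (suc d) n ℙ.+ (x ℙ.+ boundary (suc s) d n)) (1+q^-term s d n) ⟩
  boundary s (suc d) n ℙ.+ (boundary s (suc d) n ℙ.+ boundary (suc s) d n)
    ≡⟨ p+[p+q]≡q (boundary s (suc d) n) _ ⟩
  boundary (suc s) d n ∎
  where
  open ≡-Reasoning
  S  = partialSum s (suc d) n
  S′ = partialSum s (suc (suc d)) n
  T  = term (suc s) d n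

partialSum-≤ : ∀ s d {n} → n ≤ s + d → partialSum s d n ≡ ∏ zero (s + d) δ n
partialSum-≤ zero    d n≤d = refl
partialSum-≤ (suc s) d {n} n≤ = begin
  partialSum s (suc d) n ℙ.+ term (suc s) d n
    ≡⟨ cong₂ ℙ._+_ (partialSum-≤ s (suc d) (subst (n ≤_) (sym (+-suc s d)) n≤))
                   (shift-< (∏ (suc s) d δ) n<e) ⟩
  ∏ zero (s + suc d) δ n ℙ.+ 0ℙ
    ≡⟨ ℙ.+-identityʳ _ ⟩
  ∏ zero (s + suc d) δ n
    ≡⟨ cong (λ k → ∏ zero k δ n) (+-suc s d) ⟩
  ∏ zero (suc s + d) δ n ∎
  where
  open ≡-Reasoning
  -- The product alone gives only `≤`; strictness comes from `triangle (suc s)` being positive.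
  n<e : n < suc s * (suc s + d) + triangle (suc s)
  n<e = ≤-<-trans (≤-trans n≤ (m≤n*m (suc s + d) (suc s))) (m<m+n _ z<s)

-- For k ≥ 1, the generalized pentagonal numbers k(3k ∓ 1)/2 satisfy
-- 24 · k(3k ∓ 1)/2 + 1 = (6k ∓ 1)².

-- The minus sign with k = n + 1, where 6k - 1 is `6 * n + 5`.
boundary-exponent : ∀ n → 24 * (suc n * (n + 1) + triangle n) + 1 ≡ (6 * n + 5) * (6 * n + 5)
boundary-exponent n = begin
  24 * (suc n * (n + 1) + triangle n) + 1              ≡⟨ expand n (triangle n) ⟩
  24 * (suc n * (n + 1)) + 12 * (2 * triangle n) + 1   ≡⟨ cong (λ u → 24 * (suc n * (n + 1)) + 12 * u + 1) (triangle*2 n) ⟩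
  24 * (suc n * (n + 1)) + 12 * (n * suc n) + 1        ≡⟨ collect n ⟩
  (6 * n + 5) * (6 * n + 5)                            ∎
  where
  open ≡-Reasoning
  expand : ∀ n t → 24 * (suc n * (n + 1) + t) + 1 ≡ 24 * (suc n * (n + 1)) + 12 * (2 * t) + 1
  expand = solve-∀
  collect : ∀ n → 24 * (suc n * (n + 1)) + 12 * (n * suc n) + 1 ≡ (6 * n + 5) * (6 * n + 5)
  collect = solve-∀

term-exponent : ∀ k → 24 * (k * (k + 0) + triangle k) + 1 ≡ (6 * k + 1) * (6 * k + 1)
term-exponent k = begin
  24 * (k * (k + 0) + triangle k) + 1         ≡⟨ expand k (triangle k) ⟩
  24 * (k * k) + 12 * (2 * triangle k) + 1    ≡⟨ cong (λ u → 24 * (k * k) + 12 * u + 1) (triangle*2 k) ⟩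
  24 * (k * k) + 12 * (k * suc k) + 1         ≡⟨ collect k ⟩
  (6 * k + 1) * (6 * k + 1)                   ∎
  where
  open ≡-Reasoning
  expand : ∀ k t → 24 * (k * (k + 0) + t) + 1 ≡ 24 * (k * k) + 12 * (2 * t) + 1
  expand = solve-∀
  collect : ∀ k → 24 * (k * k) + 12 * (k * suc k) + 1 ≡ (6 * k + 1) * (6 * k + 1)
  collect = solve-∀

-- At d = 0 the products are empty, so going from `n` to `suc n` adds two single powers of `q`:
-- `boundary n zero` and `term (suc n) zero`, of exponents k(3k - 1)/2 and k(3k + 1)/2 for k = n +
-- 1. Neither exponent can be `N`.
partialSum-diagonal : ∀ {N} → (∀ x → x * x ≢ 24 * N + 1) → ∀ n → partialSum n zero N ≡ 0ℙ
-- The initial sum is the series 1; `N = 0` is excluded because 24 · 0 + 1 = 1².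
partialSum-diagonal nonsquare zero = shift-δ 0 _ λ { refl → nonsquare 1 refl }
partialSum-diagonal {N} nonsquare (suc n) = begin
  partialSum n 1 N ℙ.+ term (suc n) zero N
    ≡⟨ cong (partialSum n 1 N ℙ.+_) term≡0 ⟩
  partialSum n 1 N ℙ.+ 0ℙ
    ≡⟨ ℙ.+-identityʳ _ ⟩
  partialSum n 1 N
    -- Adding `partialSum n zero N` twice changes nothing and exposes the sum that `partialSum-suc`
    -- evaluates.
    ≡⟨ p+[p+q]≡q (partialSum n zero N) _ ⟨
  partialSum n zero N ℙ.+ (partialSum n zero N ℙ.+ partialSum n 1 N)
    ≡⟨ cong₂ ℙ._+_ (partialSum-diagonal nonsquare n)
                   (trans (partialSum-suc n zero N) boundary≡0) ⟩
  0ℙ ∎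
  where
  open ≡-Reasoning
  boundary≡0 : boundary n zero N ≡ 0ℙ
  boundary≡0 = shift-δ (suc n * (n + 1) + triangle n) N
    λ { refl → nonsquare (6 * n + 5) (sym (boundary-exponent n)) }
  term≡0 : term (suc n) zero N ≡ 0ℙ
  term≡0 = shift-δ (suc n * (suc n + 0) + triangle (suc n)) N
    λ { refl → nonsquare (6 * suc n + 1) (sym (term-exponent (suc n))) }

pentagonal : ∀ N → (∀ x → x * x ≢ 24 * N + 1) → ∏ zero N δ N ≡ 0ℙ
pentagonal N nonsquare = begin
  ∏ zero N δ N        ≡⟨ cong (λ k → ∏ zero k δ N) (+-identityʳ N) ⟨
  ∏ zero (N + 0) δ N  ≡⟨ partialSum-≤ N zero (m≤m+n N 0) ⟨
  partialSum N zero N ≡⟨ partialSum-diagonal nonsquare N ⟩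
  0ℙ                  ∎
  where open ≡-Reasoning

-- Counting regular partitions

length-filter-concatMap : {P : Pred B p′} (P? : Decidable P) (h : A → List B) (xs : List A) →
  length (filter P? (concatMap h xs)) ≡ sum (map (λ x → length (filter P? (h x))) xs)
length-filter-concatMap P? h []       = refl
length-filter-concatMap P? h (x ∷ xs) = begin
  length (filter P? (h x ++ concatMap h xs))
    ≡⟨ cong length (filter-++ P? (h x) _) ⟩
  length (filter P? (h x) ++ filter P? (concatMap h xs))
    ≡⟨ length-++ (filter P? (h x)) ⟩
  length (filter P? (h x)) + length (filter P? (concatMap h xs))
    ≡⟨ cong (_+_ (length (filter P? (h x)))) (length-filter-concatMap P? h xs) ⟩
  sum (map (λ x → length (filter P? (h x))) (x ∷ xs)) ∎
  where open ≡-Reasoning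

sum-map-0 : (h : A → ℕ) → (∀ x → h x ≡ 0) → ∀ xs → sum (map h xs) ≡ 0
sum-map-0 h h≡0 []       = refl
sum-map-0 h h≡0 (x ∷ xs) = cong₂ _+_ (h≡0 x) (sum-map-0 h h≡0 xs)

sum-map-upTo-suc : ∀ (h : ℕ → ℕ) n →
  sum (map h (upTo (suc n))) ≡ h 0 + sum (map (h ∘ suc) (upTo n))
sum-map-upTo-suc h n = cong (λ xs → h 0 + sum xs) (begin
  map h (applyUpTo suc n)    ≡⟨ cong (map h) (map-upTo suc n) ⟨
  map h (map suc (upTo n))   ≡⟨ map-∘ (upTo n) ⟨
  map (h ∘ suc) (upTo n)     ∎)
  where open ≡-Reasoning

module _ (ℓ : ℕ) where

  regularCount : List (List ℕ) → ℕ
  regularCount = length ∘ filter (regular? ℓ)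

  count : (k n : ℕ) → ℕ
  count k n = regularCount (partitions≤ k n)

  regularCount-map-++ : ∀ {ys} → Regular ℓ ys → ∀ xss →
    regularCount (map (ys ++_) xss) ≡ regularCount xss
  regularCount-map-++ reg [] = refl
  regularCount-map-++ {ys} reg (xs ∷ xss) with regular? ℓ (ys ++ xs) | regular? ℓ xs
  ... | yes _   | yes _   = cong suc (regularCount-map-++ reg xss)
  ... | no _    | no _    = regularCount-map-++ reg xss
  ... | yes reg′ | no ¬reg = contradiction (All.++⁻ʳ ys reg′) ¬reg
  ... | no ¬reg | yes reg′ = contradiction (All.++⁺ reg reg′) ¬reg

  regularCount-map-∷ : ∀ {x} → ℓ ∣ x → ∀ ys xss →
    regularCount (map ((x ∷ ys) ++_) xss) ≡ 0
  regularCount-map-∷ {x} ℓ∣x ys xss = cong length (filter-none (regular? ℓ)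
    (All.map⁺ (All.universal irregular xss)))
    where
    irregular : ∀ zs → ¬ Regular ℓ (x ∷ ys ++ zs)
    irregular zs (ℓ∤x ∷ _) = ℓ∤x ℓ∣x

  multiplicityCount : (k n m : ℕ) → ℕ
  multiplicityCount k n m =
    regularCount (map (replicate m (suc k) ++_) (partitions≤ k (n ∸ m * suc k)))

  count-suc : ∀ k n →
    count (suc k) n ≡ sum (map (multiplicityCount k n) (upTo (suc (n / suc k))))
  count-suc k n = length-filter-concatMap (regular? ℓ)
    (λ m → map (replicate m (suc k) ++_) (partitions≤ k (n ∸ m * suc k))) (upTo (suc (n / suc k)))

  -- Any positive multiplicity of the part `suc k` destroys regularity, so only multiplicity 0
  -- counts.
  count-divisible : ∀ {k} → ℓ ∣ suc k → ∀ n → count (suc k) n ≡ count k n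
  count-divisible {k} ℓ∣k n = begin
    count (suc k) n
      ≡⟨ count-suc k n ⟩
    sum (map (multiplicityCount k n) (upTo (suc (n / suc k))))
      ≡⟨ sum-map-upTo-suc (multiplicityCount k n) (n / suc k) ⟩
    multiplicityCount k n 0 + sum (map (multiplicityCount k n ∘ suc) (upTo (n / suc k)))
      ≡⟨ cong₂ _+_ (regularCount-map-++ [] (partitions≤ k n))
                   (sum-map-0 (multiplicityCount k n ∘ suc) no-part (upTo (n / suc k))) ⟩
    count k n + 0
      ≡⟨ +-identityʳ _ ⟩
    count k n ∎
    where
    open ≡-Reasoning
    no-part : ∀ m → multiplicityCount k n (suc m) ≡ 0
    no-part m = regularCount-map-∷ ℓ∣k (replicate m (suc k)) (partitions≤ k (n ∸ suc m * suc k))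

  module _ {k} (ℓ∤k : ¬ (ℓ ∣ suc k)) where

    count-indivisible : ∀ n →
      count (suc k) n ≡ sum (map (λ m → count k (n ∸ m * suc k)) (upTo (suc (n / suc k))))
    count-indivisible n = trans (count-suc k n) (cong sum (map-cong
      (λ m → regularCount-map-++ (All.replicate⁺ m ℓ∤k) (partitions≤ k (n ∸ m * suc k)))
      (upTo (suc (n / suc k)))))

    count-indivisible-< : ∀ {n} → n < suc k → count (suc k) n ≡ count k n
    count-indivisible-< {n} n<k = begin
      count (suc k) n
        ≡⟨ count-indivisible n ⟩
      sum (map (λ m → count k (n ∸ m * suc k)) (upTo (suc (n / suc k))))
        ≡⟨ cong (λ t → sum (map (λ m → count k (n ∸ m * suc k)) (upTo (suc t)))) (m<n⇒m/n≡0 n<k) ⟩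
      count k n + 0
        ≡⟨ +-identityʳ _ ⟩
      count k n ∎
      where open ≡-Reasoning

    -- Either `suc k` does not occur, or one copy of it can be removed. For generating functions:
    -- `(1 - q^(k+1)) C_(k+1) = C_k`.
    count-indivisible-+ : ∀ n → count (suc k) (suc k + n) ≡ count k (suc k + n) + count (suc k) n
    count-indivisible-+ n = begin
      count (suc k) (suc k + n)
        ≡⟨ count-indivisible (suc k + n) ⟩
      sum (map h (upTo (suc ((suc k + n) / suc k))))
        ≡⟨ sum-map-upTo-suc h ((suc k + n) / suc k) ⟩
      count k (suc k + n) + sum (map (h ∘ suc) (upTo ((suc k + n) / suc k)))
        ≡⟨ cong (λ xs → count k (suc k + n) + sum xs)
             (trans (cong (λ t → map (h ∘ suc) (upTo t)) quotient)
                    (map-cong (λ m → cong (count k) ([m+n]∸[m+o]≡n∸o (suc k) n (m * suc k)))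
                             (upTo (suc (n / suc k))))) ⟩
      count k (suc k + n) + sum (map (λ m → count k (n ∸ m * suc k)) (upTo (suc (n / suc k))))
        ≡⟨ cong (_+_ (count k (suc k + n))) (count-indivisible n) ⟨
      count k (suc k + n) + count (suc k) n ∎
      where
      open ≡-Reasoning
      h = λ m → count k (suc k + n ∸ m * suc k)
      quotient : (suc k + n) / suc k ≡ suc (n / suc k)
      quotient = trans (m/n≡1+[m∸n]/n (m≤m+n (suc k) n))
                       (cong (λ t → suc (t / suc k)) (m+n∸m≡n (suc k) n))

  count-< : ∀ {k n} → n < suc k → count (suc k) n ≡ count k n
  count-< {k} {n} n<k with ℓ ∣? suc k
  ... | yes ℓ∣k = count-divisible ℓ∣k n
  ... | no  ℓ∤k = count-indivisible-< ℓ∤k n<k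

  -- Parts larger than `n` cannot occur. This allows the bound in `b` to be raised to `n + n` in
  -- `parity-b₂`.
  count-stable : ∀ d n → count (d + n) n ≡ count n n
  count-stable zero    n = refl
  count-stable (suc d) n = trans (count-< (s≤s (m≤n+m n d))) (count-stable d n)

-- Euler's theorem modulo 2

-- Modulo 2, the product of `1/(1 - q^i)` over the odd i ≤ k.
series : ℕ → ℕ → Parity
series k n = parity (count 2 k n)

series-0 : series 0 ≗ δ
series-0 zero    = refl
series-0 (suc n) = refl

-- The recurrence of `count`, with `1 - q^(k+1)` read as `1 + q^(k+1)` over 𝔽₂.
series-odd : ∀ {k} → ¬ (2 ∣ suc k) → 1+q^ (suc k) (series (suc k)) ≗ series k
series-odd {k} odd n with n <? suc k
... | yes n<k = trans (1+q^-< (series (suc k)) n<k) (cong parity (count-indivisible-< 2 odd n<k))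
... | no  n≮k = subst (λ n → 1+q^ (suc k) (series (suc k)) n ≡ series k n)
                      (m+[n∸m]≡n (≮⇒≥ n≮k)) (at-sum (n ∸ suc k))
  where
  open ≡-Reasoning
  at-sum : ∀ i → 1+q^ (suc k) (series (suc k)) (suc k + i) ≡ series k (suc k + i)
  at-sum i = begin
    series (suc k) (suc k + i) ℙ.+ shift (suc k) (series (suc k)) (suc k + i)
      ≡⟨ cong₂ ℙ._+_ (trans (cong parity (count-indivisible-+ 2 odd i))
                            (ℙ.+-homo-+ (count 2 k (suc k + i)) _))
                     (shift-+ (suc k) (series (suc k)) i) ⟩
    (series k (suc k + i) ℙ.+ series (suc k) i) ℙ.+ series (suc k) i
      ≡⟨ ℙ.+-assoc (series k (suc k + i)) _ _ ⟩
    series k (suc k + i) ℙ.+ (series (suc k) i ℙ.+ series (suc k) i)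
      ≡⟨ cong (series k (suc k + i) ℙ.+_) (ℙ.p+p≡0ℙ (series (suc k) i)) ⟩
    series k (suc k + i) ℙ.+ 0ℙ
      ≡⟨ ℙ.+-identityʳ _ ⟩
    series k (suc k + i) ∎

2∣m+m : ∀ m → 2 ∣ m + m
2∣m+m m = divides m (trans (cong (_+_ m) (sym (+-identityʳ m))) (*-comm 2 m))

2∤1+m+m : ∀ m → ¬ (2 ∣ suc (m + m))
2∤1+m+m m 2∣ = contradiction (∣1⇒≡1 (∣m+n∣m⇒∣n (subst (2 ∣_) (+-comm 1 (m + m)) 2∣) (2∣m+m m))) λ ()

-- A finite form of Euler's identity. From m to m + 1, multiply both sides by `1 + q^(m+1)`. On the
-- left the factors then run from m + 1 to 2m + 2: the one at 2m + 1 cancels the new odd part, and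
-- the one at 2m + 2 is the square of `1 + q^(m+1)`, as on the right.
∏-series : ∀ m → ∏ m m (series (m + m)) ≗ ∏ zero m δ
∏-series zero    = series-0
∏-series (suc m) = 1+q^-injective m λ n → begin
  1+q^ (suc m) (∏ (suc m) (suc m) C″) n
    ≡⟨ ∏-first m (suc m) C″ n ⟩
  1+q^ (m + suc (suc m)) (1+q^ (m + suc m) (∏ m m C″)) n
    ≡⟨ 1+q^-cong (m + suc (suc m)) product n ⟩
  1+q^ (m + suc (suc m)) (∏ zero m δ) n
    ≡⟨ cong (λ k → 1+q^ k (∏ zero m δ) n) (+-suc m (suc m)) ⟩
  1+q^ (suc m + suc m) (∏ zero m δ) n
    ≡⟨ 1+q^-square (suc m) (∏ zero m δ) n ⟨
  1+q^ (suc m) (∏ zero (suc m) δ) n ∎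
  where
  open ≡-Reasoning
  C″ = series (suc m + suc m)
  C′ = series (suc (m + m))
  -- The part 2m + 2 is even, so allowing it adds no 2-regular partition.
  even : C″ ≗ C′
  even n = trans (cong (λ k → series (suc k) n) (+-suc m m)) (cong parity
    (count-divisible 2 (subst (2 ∣_) (cong suc (+-suc m m)) (2∣m+m (suc m))) n))
  product : 1+q^ (m + suc m) (∏ m m C″) ≗ ∏ zero m δ
  product n = begin
    1+q^ (m + suc m) (∏ m m C″) n    ≡⟨ cong (λ k → 1+q^ k (∏ m m C″) n) (+-suc m m) ⟩
    1+q^ (suc (m + m)) (∏ m m C″) n  ≡⟨ ∏-1+q^ m m (suc (m + m)) C″ n ⟨
    ∏ m m (1+q^ (suc (m + m)) C″) n  ≡⟨ ∏-cong m m (1+q^-cong (suc (m + m)) even) n ⟩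
    ∏ m m (1+q^ (suc (m + m)) C′) n  ≡⟨ ∏-cong m m (series-odd (2∤1+m+m m)) n ⟩
    ∏ m m (series (m + m)) n         ≡⟨ ∏-series m n ⟩
    ∏ zero m δ n                     ∎

-- `∏-series` at m = n: the extra factors there have exponents above `n` and do not affect this
-- coefficient.
parity-b₂ : ∀ n → parity (b 2 n) ≡ ∏ zero n δ n
parity-b₂ n = begin
  parity (b 2 n)              ≡⟨ cong parity (count-stable 2 n n) ⟨
  series (n + n) n            ≡⟨ ∏-≤ n (series (n + n)) ≤-refl ⟨
  ∏ n n (series (n + n)) n    ≡⟨ ∏-series n n ⟩
  ∏ zero n δ n                ∎
  where open ≡-Reasoning

parity≡0ℙ⇒%2≡0 : ∀ n → parity n ≡ 0ℙ → n % 2 ≡ 0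
parity≡0ℙ⇒%2≡0 zero          _  = refl
parity≡0ℙ⇒%2≡0 (suc (suc n)) eq =
  trans (cong (_% 2) (+-comm 2 n)) (trans ([m+n]%n≡m%n n 2) (parity≡0ℙ⇒%2≡0 n eq))

b₂-even : ∀ N → (∀ x → x * x ≢ 24 * N + 1) → b 2 N % 2 ≡ 0
b₂-even N nonsquare = parity≡0ℙ⇒%2≡0 (b 2 N) (trans (parity-b₂ N) (pentagonal N nonsquare))

-- Squares and residues

-- Checked residue by residue: those coprime to 6 have square 1 modulo 24.
residue-mod-24 : ∀ (r : Fin 24) → (2 ∣ toℕ r ⊎ 3 ∣ toℕ r) ⊎ toℕ r * toℕ r % 24 ≡ 1
residue-mod-24 = toWitness {a? = Fin.all? λ r →
  (2 ∣? toℕ r ⊎-dec 3 ∣? toℕ r) ⊎-dec (toℕ r * toℕ r % 24 ≟ 1)} _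

-- As 2 and 3 divide 24, either of them dividing the residue would divide `p`, which is a prime ≥ 5.
prime²%24≡1 : ∀ {p} → Prime p → 5 ≤ p → p ^ 2 % 24 ≡ 1
prime²%24≡1 {p} pp 5≤p = [ (λ small → contradiction small not-small) , square ]′ (residue-mod-24 r)
  where
  open ≡-Reasoning
  instance _ = prime⇒nonZero pp
  r = p mod 24
  r≡ : toℕ r ≡ p % 24
  r≡ = toℕ-fromℕ< (m%n<n p 24)
  square : toℕ r * toℕ r % 24 ≡ 1 → p ^ 2 % 24 ≡ 1
  square eq = begin
    p ^ 2 % 24                  ≡⟨ cong (λ q → p * q % 24) (*-identityʳ p) ⟩
    p * p % 24                  ≡⟨ %-distribˡ-* p p 24 ⟩
    (p % 24) * (p % 24) % 24    ≡⟨ cong (λ r → r * r % 24) r≡ ⟨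
    toℕ r * toℕ r % 24          ≡⟨ eq ⟩
    1                           ∎
  excluded : ∀ d → d ∣ 24 → d ≢ 1 → d < 5 → ¬ (d ∣ toℕ r)
  excluded d d∣24 d≢1 d<5 d∣r
    with prime⇒irreducible pp (∣n∣m%n⇒∣m d∣24 (subst (d ∣_) r≡ d∣r))
  ... | inj₁ d≡1 = d≢1 d≡1
  ... | inj₂ d≡p = <⇒≱ d<5 (subst (5 ≤_) (sym d≡p) 5≤p)
  not-small : ¬ (2 ∣ toℕ r ⊎ 3 ∣ toℕ r)
  not-small = [ excluded 2 (divides 12 refl) (λ ()) (toWitness {a? = 2 <? 5} _)
              , excluded 3 (divides 8 refl) (λ ()) (toWitness {a? = 3 <? 5} _) ]′

∏²%24≡1 : ∀ {m} (v : Vector ℕ m) → (∀ s → Prime (v s)) → (∀ s → 5 ≤ v s) → ∏² v % 24 ≡ 1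
∏²%24≡1 {zero}  v primes 5≤ = refl
∏²%24≡1 {suc m} v primes 5≤ =
  trans (%-distribˡ-* (v zero ^ 2) (∏² (tail v)) 24)
        (cong₂ (λ x y → x * y % 24) (prime²%24≡1 (primes zero) (5≤ zero))
                                    (∏²%24≡1 (tail v) (primes ∘ suc) (5≤ ∘ suc)))

-- By Euclid's lemma `p` divides `x`; writing `x` as `y * p`, the factor `p ^ 2` cancels.
prime²*-square : ∀ {p a x} → Prime p → p ^ 2 * a ≡ x * x → ∃ λ y → a ≡ y * y
prime²*-square {p} {a} {x} pp eq
  with [ id , id ]′ (euclidsLemma x x pp (divides (p * a) (trans (sym eq) (lemma p a))))
  where
  lemma : ∀ p a → p * (p * 1) * a ≡ p * a * p
  lemma = solve-∀
... | divides y refl = y , *-cancelˡ-≡ a (y * y) (p ^ 2) {{m^n≢0 p 2}} (trans eq (lemma y p))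
  where
  instance _ = prime⇒nonZero pp
  lemma : ∀ y p → y * p * (y * p) ≡ p * (p * 1) * (y * y)
  lemma = solve-∀

∏²*-square : ∀ {m} (v : Vector ℕ m) → (∀ s → Prime (v s)) → ∀ {a x} →
  ∏² v * a ≡ x * x → ∃ λ y → a ≡ y * y
∏²*-square {zero}  v primes {a} {x} eq = x , trans (sym (*-identityˡ a)) eq
∏²*-square {suc m} v primes {a} {x} eq
  with prime²*-square {x = x} (primes zero) (trans (sym (*-assoc (v zero ^ 2) (∏² (tail v)) a)) eq)
... | y , eq′ = ∏²*-square (tail v) (primes ∘ suc) {x = y} eq′

square⇒squareMod : ∀ {p} .{{_ : NonZero p}} a k y → y * y ≡ p * k + a → SquareMod p (+ a)
square⇒squareMod {p} a k y eq = fromℕ< (m%n<n y p) ,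
  subst (λ r → + p ℤ.∣ + r ℤ.* + r ℤ.- + a) (sym (toℕ-fromℕ< (m%n<n y p)))
    -- With y = R + QP, R² = y² - Q(2R + QP)P, and y² - a = PK by hypothesis; this gives the
    -- quotient.
    (ℤ.divides (K ℤ.- Q ℤ.* (R ℤ.+ R ℤ.+ Q ℤ.* P)) (begin
      R ℤ.* R ℤ.- + a
        ≡⟨ complete-square R Q P (+ a) ⟩
      (R ℤ.+ Q ℤ.* P) ℤ.* (R ℤ.+ Q ℤ.* P) ℤ.- (Q ℤ.* (R ℤ.+ R ℤ.+ Q ℤ.* P) ℤ.* P ℤ.+ + a)
        ≡⟨ cong (ℤ._- (Q ℤ.* (R ℤ.+ R ℤ.+ Q ℤ.* P) ℤ.* P ℤ.+ + a)) eqℤ ⟩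
      (P ℤ.* K ℤ.+ + a) ℤ.- (Q ℤ.* (R ℤ.+ R ℤ.+ Q ℤ.* P) ℤ.* P ℤ.+ + a)
        ≡⟨ factor P K (Q ℤ.* (R ℤ.+ R ℤ.+ Q ℤ.* P)) (+ a) ⟩
      (K ℤ.- Q ℤ.* (R ℤ.+ R ℤ.+ Q ℤ.* P)) ℤ.* P ∎))
  where
  open ≡-Reasoning
  R = + (y % p)
  Q = + (y / p)
  P = + p
  K = + k
  complete-square : ∀ R Q P A → R ℤ.* R ℤ.- A ≡
    (R ℤ.+ Q ℤ.* P) ℤ.* (R ℤ.+ Q ℤ.* P) ℤ.- (Q ℤ.* (R ℤ.+ R ℤ.+ Q ℤ.* P) ℤ.* P ℤ.+ A)
  complete-square = ℤ-Solver.solve-∀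
  factor : ∀ P K Z A → (P ℤ.* K ℤ.+ A) ℤ.- (Z ℤ.* P ℤ.+ A) ≡ (K ℤ.- Z) ℤ.* P
  factor = ℤ-Solver.solve-∀
  y≡ : + y ≡ R ℤ.+ Q ℤ.* P
  y≡ = trans (cong +_ (m≡m%n+[m/n]*n y p)) (cong (λ z → R ℤ.+ z) (ℤ.pos-* (y / p) p))
  eqℤ : (R ℤ.+ Q ℤ.* P) ℤ.* (R ℤ.+ Q ℤ.* P) ≡ P ℤ.* K ℤ.+ + a
  eqℤ = begin
    (R ℤ.+ Q ℤ.* P) ℤ.* (R ℤ.+ Q ℤ.* P) ≡⟨ cong₂ ℤ._*_ y≡ y≡ ⟨
    + y ℤ.* + y                         ≡⟨ ℤ.pos-* y y ⟨
    + (y * y)                           ≡⟨ cong +_ eq ⟩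
    + (p * k) ℤ.+ + a                   ≡⟨ cong (ℤ._+ + a) (ℤ.pos-* p k) ⟩
    P ℤ.* K ℤ.+ + a                     ∎

legendre≡-1⇒¬squareMod : ∀ {a p} → legendre a p ≡ -1ℤ → ¬ SquareMod p a
legendre≡-1⇒¬squareMod {a} {p} eq with + p ℤ.∣? a | squareMod? p a
legendre≡-1⇒¬squareMod () | yes _ | _
legendre≡-1⇒¬squareMod () | no _  | yes _
legendre≡-1⇒¬squareMod _  | no _  | no ¬square = ¬square

-- The truncated division in the theorem is exact for numerators of this form.
24*[m∸1]/24+1 : ∀ {m} → m % 24 ≡ 1 → 24 * ((m ∸ 1) / 24) + 1 ≡ m
24*[m∸1]/24+1 {m} m%24≡1 = begin
  24 * ((m ∸ 1) / 24) + 1             ≡⟨ cong (λ t → 24 * ((t ∸ 1) / 24) + 1) m≡ ⟩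
  24 * ((m / 24 * 24) / 24) + 1       ≡⟨ cong (λ t → 24 * t + 1) (m*n/n≡m (m / 24) 24) ⟩
  24 * (m / 24) + 1                   ≡⟨ +-comm _ 1 ⟩
  1 + 24 * (m / 24)                   ≡⟨ cong suc (*-comm 24 (m / 24)) ⟩
  1 + m / 24 * 24                     ≡⟨ m≡ ⟨
  m                                   ∎
  where
  open ≡-Reasoning
  m≡ : m ≡ 1 + m / 24 * 24
  m≡ = trans (m≡m%n+[m/n]*n m 24) (cong (_+ m / 24 * 24) m%24≡1)

theorem3p7 : ∀ (r-1 : ℕ) (p : Vector ℕ (suc r-1)) →
    (∀ (s : Fin (suc r-1)) → Prime (p s)) →
    (∀ (s : Fin (suc r-1)) → 5 ≤ p s) →
    ∀ (n j : ℕ) → j ≤ last p ∸ 1 →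
    legendre (+ (24 * j + 1)) (last p) ≡ -1ℤ →
    b 2 (∏² (init p) * last p * n + ((24 * j + 1) * ∏² (init p) ∸ 1) / 24) % 2 ≡ 0
theorem3p7 r-1 p primes 5≤p n j _ nonresidue = b₂-even N nonsquare
  where
  open ≡-Reasoning
  P = ∏² (init p)
  q = last p
  D = ((24 * j + 1) * P ∸ 1) / 24
  N = P * q * n + D
  instance _ = prime⇒nonZero (primes (fromℕ r-1))
  24j+1%24≡1 : (24 * j + 1) % 24 ≡ 1
  24j+1%24≡1 = trans (cong (_% 24) (trans (+-comm (24 * j) 1) (cong suc (*-comm 24 j))))
                     ([m+kn]%n≡m%n 1 j 24)
  -- Both `24 * j + 1` and the product of prime squares `P` are 1 modulo 24.
  exact : 24 * D + 1 ≡ (24 * j + 1) * P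
  exact = 24*[m∸1]/24+1 (begin
    (24 * j + 1) * P % 24
      ≡⟨ %-distribˡ-* (24 * j + 1) P 24 ⟩
    (24 * j + 1) % 24 * (P % 24) % 24
      ≡⟨ cong₂ (λ x y → x * y % 24) 24j+1%24≡1
           (∏²%24≡1 (init p) (primes ∘ inject₁) (5≤p ∘ inject₁)) ⟩
    1 ∎)
  expand : ∀ c P q n D → c * (P * q * n + D) + 1 ≡ P * (q * (c * n)) + (c * D + 1)
  expand = solve-∀
  factor : ∀ P k a → P * k + a * P ≡ P * (k + a)
  factor = solve-∀
  24N+1≡ : 24 * N + 1 ≡ P * (q * (24 * n) + (24 * j + 1))
  24N+1≡ = begin
    24 * N + 1                              ≡⟨ expand 24 P q n D ⟩
    P * (q * (24 * n)) + (24 * D + 1)       ≡⟨ cong (_+_ (P * (q * (24 * n)))) exact ⟩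
    P * (q * (24 * n)) + (24 * j + 1) * P   ≡⟨ factor P (q * (24 * n)) (24 * j + 1) ⟩
    P * (q * (24 * n) + (24 * j + 1))       ∎
  not-square : ¬ ∃ λ y → q * (24 * n) + (24 * j + 1) ≡ y * y
  not-square (y , eq) =
    legendre≡-1⇒¬squareMod nonresidue (square⇒squareMod (24 * j + 1) (24 * n) y (sym eq))
  nonsquare : ∀ x → x * x ≢ 24 * N + 1
  nonsquare x eq =
    not-square (∏²*-square (init p) (primes ∘ inject₁) {x = x} (sym (trans eq 24N+1≡)))
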